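{- Let $m\ge 2$. For $n\ge 0$ define $$Q^{(m)}_{n,123}(s,x_2,\ldots,x_m)=\sum_{\sigma\in\mathcal{S}_n(123)}s^{\mathrm{LRmin}(\sigma)}x_2^{\mathrm{occr}_{12}(\sigma)}x_3^{\mathrm{occr}_{132}(\sigma)}\cdots x_m^{\mathrm{occr}_{1m(m-1)\cdots 2}(\sigma)},$$ $$Q^{(m)}_{123}(t,s,x_2,\ldots,x_m)=\sum_{n\ge 0}t^nQ^{(m)}_{n,123}(s,x_2,\ldots,x_m).$$ Then for every $n\ge 1$, $$Q^{(m)}_{n,123}(s,x_2,\ldots,x_m)=s\,Q^{(m)}_{n-1,123}(s,x_2,\ldots,x_m)+\sum_{k=2}^{n}Q^{(m)}_{k-1,123}(sx_2,\,x_2x_3,\,x_3x_4,\ldots,x_{m-1}x_m,\,x_m)\,Q^{(m)}_{n-k,123}(s,x_2,\ldots,x_m),$$ and $$\begin{aligned}Q^{(m)}_{123}(t,s,x_2,\ldots,x_m)=1&+t(s-1)\,Q^{(m)}_{123}(t,s,x_2,\ldots,x_m)\\&+t\,Q^{(m)}_{123}(t,\,sx_2,\,x_2x_3,\,x_3x_4,\ldots,x_{m-1}x_m,\,x_m)\,Q^{(m)}_{123}(t,s,x_2,\ldots,x_m).\end{aligned}$$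
   Context: $\mathcal{S}_n$ is the set of permutations of $\{1,\ldots,n\}$ in one-line notation ($\mathcal{S}_0$ consists of the empty permutation, so the $n=0$ polynomial is $1$). For a sequence $w$ of distinct integers, $\mathrm{red}(w)$ is the permutation obtained by replacing the $i$-th smallest entry of $w$ by $i$. For $\tau\in\mathcal{S}_j$ and $\sigma=\sigma_1\cdots\sigma_n\in\mathcal{S}_n$, $\mathrm{occr}_\tau(\sigma)$ is the number of index sets $1\le i_1<\cdots<i_j\le n$ with $\mathrm{red}(\sigma_{i_1}\cdots\sigma_{i_j})=\tau$. $\mathcal{S}_n(123)$ is the set of $\sigma\in\mathcal{S}_n$ with $\mathrm{occr}_{123}(\sigma)=0$. The entry $\sigma_j$ is a left-to-right minimum of $\sigma$ if $\sigma_i>\sigma_j$ for all $i<j$; $\mathrm{LRmin}(\sigma)$ is the number of left-to-right minima. For $j\ge2$, $1j(j-1)\cdots2$ denotes the pattern in $\mathcal{S}_j$ with first entry $1$ followed by $j,j-1,\ldots,2$ (so $12$ for $j=2$, $132$ for $j=3$); the exponent of $x_j$ is the number of its occurrences. In the argument list $(sx_2,x_2x_3,\ldots,x_{m-1}x_m,x_m)$, $s$ is replaced by $sx_2$, $x_i$ by $x_ix_{i+1}$ for $2\le i\le m-1$, and $x_m$ is unchanged (for $m=2$ the list is $(sx_2,x_2)$). -}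

module Defs where

open import Algebra.Bundles using (CommutativeRing)
open import Data.Fin.Base as Fin using (Fin)
import Data.Fin.Properties as Fin
open import Data.List.Base
  using (List; []; _∷_; [_]; _++_; map; filter; foldr; length; reverse;
         lookup; allFin; applyUpTo; cartesianProductWith)
open import Data.List.Properties using (≡-dec)
open import Data.List.Relation.Unary.Unique.DecPropositional using (unique?)
open import Data.Nat.Base using (ℕ; zero; suc; _+_; _∸_; _<_)
open import Data.Nat.Properties using (_≟_; _≤?_; _<?_)
open import Data.Vec.Base using (Vec; []; _∷_)
open import Relation.Nullary.Decidable using (Dec; _→-dec_)

-- The integers a, a + 1, …, b (none if b < a).
range : ℕ → ℕ → List ℕ
range a b = applyUpTo (a +_) (suc b ∸ a)

words : List ℕ → ℕ → List (List ℕ)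
words A zero    = [ [] ]
words A (suc k) = cartesianProductWith _∷_ A (words A k)

-- 𝒮ₙ in one-line notation, each permutation listed exactly once.
perms : ℕ → List (List ℕ)
perms n = filter (unique? _≟_) (words (range 1 n) n)

-- For w with distinct entries, the i-th smallest entry is the one having
-- exactly i entries ≤ it.
red : List ℕ → List ℕ
red w = map (λ x → length (filter (_≤? x) w)) w

-- The subsequences of w of length j, one for each index set i₁ < ⋯ < iⱼ.
subsequences : ℕ → List ℕ → List (List ℕ)
subsequences zero    w       = [ [] ]
subsequences (suc j) []      = []
subsequences (suc j) (x ∷ w) = map (x ∷_) (subsequences j w) ++ subsequences (suc j) w

occr : List ℕ → List ℕ → ℕ
occr τ σ = length (filter (λ u → ≡-dec _≟_ (red u) τ) (subsequences (length τ) σ))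

perms123 : ℕ → List (List ℕ)
perms123 n = filter (λ σ → occr (1 ∷ 2 ∷ 3 ∷ []) σ ≟ 0) (perms n)

IsLRmin : (σ : List ℕ) → Fin (length σ) → Set
IsLRmin σ j = ∀ i → i Fin.< j → lookup σ j < lookup σ i

isLRmin? : ∀ σ j → Dec (IsLRmin σ j)
isLRmin? σ j = Fin.all? λ i → (i Fin.<? j) →-dec (lookup σ j <? lookup σ i)

LRmin : List ℕ → ℕ
LRmin σ = length (filter (isLRmin? σ) (allFin (length σ)))

-- The pattern 1 j (j-1) ⋯ 2, for j ≥ 2.
pattern1↓ : ℕ → List ℕ
pattern1↓ j = 1 ∷ reverse (range 2 j)

-- The variables s, x₂, …, xₘ are arbitrary elements of a commutative ring R;
-- taking R = ℤ[s,x₂,…,xₘ] and its generators gives the polynomials themselves.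
-- The list x₂, …, xₘ is a vector whose first component is x₂.
module GeneratingFunctions {c ℓ} (R : CommutativeRing c ℓ) where

  open CommutativeRing R
    using (Carrier; _≈_; 0#; 1#; semiring)
    renaming (_+_ to _+ᴿ_; _*_ to _*ᴿ_)
  open import Algebra.Properties.Semiring.Exp semiring using (_^_)

  sum : ∀ {a} {A : Set a} → List A → (A → Carrier) → Carrier
  sum as f = foldr (λ a r → f a +ᴿ r) 0# as

  -- x_j ^ occr_{1j⋯2}(σ) · x_{j+1} ^ occr_{1(j+1)j⋯2}(σ) ⋯, where j is the
  -- index of the first variable in the vector.
  xWeight : ∀ {p} → ℕ → Vec Carrier p → List ℕ → Carrier
  xWeight j []       σ = 1#
  xWeight j (x ∷ xs) σ = (x ^ occr (pattern1↓ j) σ) *ᴿ xWeight (suc j) xs σ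

  Qₙ : ∀ {p} → ℕ → Carrier → Vec Carrier p → Carrier
  Qₙ n s x = sum (perms123 n) λ σ → (s ^ LRmin σ) *ᴿ xWeight 2 x σ

  -- The replaced arguments s x₂ and x₂x₃, …, x_{m-1}x_m, x_m.  The case of no
  -- x's (m = 1) only serves to make ŝ total.
  ŝ : ∀ {p} → Carrier → Vec Carrier p → Carrier
  ŝ s []       = s
  ŝ s (x₂ ∷ _) = s *ᴿ x₂

  x̂ : ∀ {p} → Vec Carrier p → Vec Carrier p
  x̂ []           = []
  x̂ (x ∷ [])     = x ∷ []
  x̂ (x ∷ y ∷ xs) = (x *ᴿ y) ∷ x̂ (y ∷ xs)

  -- Formal power series in t over R, given by their coefficients.
  Series : Set c
  Series = ℕ → Carrier

  infix  4 _≈ₛ_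
  infixl 6 _⊕_
  infixl 7 _⊛_

  _≈ₛ_ : Series → Series → Set ℓ
  f ≈ₛ g = ∀ n → f n ≈ g n

  const : Carrier → Series
  const a zero    = a
  const a (suc n) = 0#

  t : Series
  t 1 = 1#
  t _ = 0#

  _⊕_ : Series → Series → Series
  (f ⊕ g) n = f n +ᴿ g n

  _⊛_ : Series → Series → Series
  (f ⊛ g) n = sum (range 0 n) λ i → f i *ᴿ g (n ∸ i)

  Q : ∀ {p} → Carrier → Vec Carrier p → Series
  Q s x n = Qₙ n s x

-- In a 123-avoiding permutation only left-to-right minima can start an
-- occurrence of 1j⋯2, and the entries to the right of such a minimum and larger
-- than it decrease.  If there are c of them, the minimum starts c C (j - 1)
-- occurrences, so that it contributes a factor peak s x c = s ∏ x_j^(c C (j - 1)).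
-- Reading the permutation from left to right and keeping track of the number of
-- unused entries larger than the current minimum gives a Dyck path whose peaks
-- at height c + 1 are the left-to-right minima with c larger entries to the
-- right; hence Qₙ is the sum of ∏ peak s x c over the Dyck paths.  Cutting a Dyck
-- path at its first return to 0 lowers all peaks of the first part by one, and
-- peak s x (c + 1) is peak c for the arguments s x₂, x₂x₃, …, xₘ by Pascal's rule.
module Submission where

open import Defs
open import Algebra.Bundles using (CommutativeRing)
import Algebra.Properties.CommutativeSemigroup as CommutativeSemigroup
import Algebra.Properties.CommutativeSemiring.Exp as Exp
open import Data.Bool.Base using (true; false)
open import Data.Fin.Base as Fin using (Fin)
open import Data.List.Base
  using (List; []; _∷_; [_]; _++_; map; filter; length; reverse; lookup;
         allFin; tabulate; applyUpTo; applyDownFrom)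
import Data.List.Properties as List
open import Data.List.Membership.Propositional using (_∈_)
open import Data.List.Membership.Propositional.Properties
  using (∈-lookup; ∈-∃++; ∈-++⁺ˡ; ∈-++⁺ʳ; ∈-++⁻; ∈-map⁺; ∈-map⁻; ∈-filter⁺; ∈-filter⁻;
         ∈-cartesianProductWith⁺; ∈-cartesianProductWith⁻)
open import Data.List.Relation.Binary.Disjoint.Propositional using (Disjoint)
open import Data.List.Relation.Binary.Permutation.Propositional as Perm
  using (_↭_; ↭-refl; ↭-sym; ↭-trans; ↭-reflexive; ↭⇒↭ₛ; prep)
open import Data.List.Relation.Binary.Permutation.Propositional.Properties
  using (∈-resp-↭; All-resp-↭; ↭-empty-inv; ↭-length; ↭-reverse; drop-∷; drop-mid;
         shift; filter-↭; ∷↭∷ʳ)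
  renaming (++-identityʳ to ↭-++-identityʳ)
import Data.List.Relation.Binary.Permutation.Setoid.Properties as ↭ₛ
open import Data.List.Relation.Binary.Subset.Propositional using (_⊆_)
open import Data.List.Relation.Unary.All as All using (All; []; _∷_)
import Data.List.Relation.Unary.All.Properties as All
open import Data.List.Relation.Unary.AllPairs as AllPairs using (AllPairs; []; _∷_)
import Data.List.Relation.Unary.AllPairs.Properties as AllPairs
open import Data.List.Relation.Unary.Any using (here; there)
open import Data.List.Relation.Unary.Unique.DecPropositional using (unique?)
open import Data.List.Relation.Unary.Unique.Propositional using (Unique)
import Data.List.Relation.Unary.Unique.Propositional.Properties as Unique
open import Data.Nat.Base using (ℕ; zero; suc; _∸_; _≤_; _<_; _>_; z≤n; s≤s)
open import Data.Nat.Combinatorics using (_C_; nCk+nC[k+1]≡[n+1]C[k+1])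
open import Data.Nat.Combinatorics.Specification using (k>n⇒nCk≡0)
open import Data.Nat.Properties
  using (_≟_; _≤?_; _<?_; _>?_; ≤-refl; ≤-reflexive; ≤-trans; ≤-antisym; ≤-pred;
         <-trans; <-≤-trans; <⇒≤; <⇒≢; >⇒≢; <⇒≱; <⇒≯; ≤⇒≯; ≮⇒≥; ≰⇒>; ≤∧≢⇒<;
         n<1+n; n≤1+n; m≤n⇒m≤1+n; m≤m+n; m≢1+m+n; +-suc)
open import Data.Product.Base using (_×_; _,_; proj₁; proj₂; ∃; ∃₂)
open import Data.Sum.Base using (inj₁; inj₂)
open import Data.Unit.Base using (⊤; tt)
open import Data.Vec.Base using (Vec; []; _∷_)
open import Function.Base using (_∘_; id; case_of_)
open import Relation.Binary.PropositionalEquality as ≡ using (_≡_; _≢_)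
open import Relation.Nullary using (¬_; yes; no; contradiction)
open import Relation.Nullary.Decidable using (_×-dec_)
open import Relation.Unary using (Pred; Decidable)

module Combinatorics where

  open import Data.Nat.Base using (_+_; _<ᵇ_)
  open import Relation.Binary.PropositionalEquality
    using (refl; sym; trans; cong; cong₂; subst; setoid; module ≡-Reasoning)

  -- Lists with distinct entries, and decreasing lists.

  unique-⊆⇒↭++ : ∀ {a} {A : Set a} {xs ys : List A} → Unique xs → xs ⊆ ys → ∃ λ zs → ys ↭ xs ++ zs
  unique-⊆⇒↭++ {ys = ys} [] _ = ys , ↭-refl
  unique-⊆⇒↭++ {xs = x ∷ xs} (x≢ ∷ u) sub with ∈-∃++ (sub (here refl))
  ... | l , r , refl =
    let zs , p = unique-⊆⇒↭++ u sub′ in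
    zs , ↭-trans (shift x l r) (prep x p)
    where
    -- Since `x` does not recur in `xs`, cutting one copy of it out of `ys` loses no entry of `xs`.
    sub′ : xs ⊆ l ++ r
    sub′ z∈ with ∈-resp-↭ (shift x l r) (sub (there z∈))
    ... | here refl = contradiction refl (All.lookup x≢ z∈)
    ... | there z∈′ = z∈′

  unique-⊆-length⇒↭ : ∀ {a} {A : Set a} {xs ys : List A} → Unique xs → xs ⊆ ys →
                      length ys ≡ length xs → xs ↭ ys
  unique-⊆-length⇒↭ {xs = xs} u sub eq with unique-⊆⇒↭++ u sub
  ... | [] , p = ↭-sym (↭-trans p (↭-++-identityʳ xs))
  ... | z ∷ zs , p = contradiction
    (trans (sym eq) (trans (↭-length p) (List.length-++ xs)))
    (m≢1+m+n (length xs) ∘ λ e → trans e (+-suc _ _))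

  unique-⇔⇒↭ : ∀ {a} {A : Set a} {xs ys : List A} → Unique xs → Unique ys →
               xs ⊆ ys → ys ⊆ xs → xs ↭ ys
  unique-⇔⇒↭ {xs = xs} {ys} ux uy xs⊆ys ys⊆xs =
    unique-⊆-length⇒↭ ux xs⊆ys (≤-antisym (shorter uy ys⊆xs) (shorter ux xs⊆ys))
    where
    shorter : ∀ {as bs} → Unique as → as ⊆ bs → length as ≤ length bs
    shorter {as} u sub with zs , p ← unique-⊆⇒↭++ u sub =
      ≤-trans (m≤m+n _ _) (≤-reflexive (sym (trans (↭-length p) (List.length-++ as))))

  Desc : List ℕ → Set
  Desc = AllPairs _>_

  desc-unique : ∀ {w} → Desc w → Unique w
  desc-unique = AllPairs.map >⇒≢

  desc-∷ʳ : ∀ {S b} → Desc S → All (b <_) S → Desc (S ++ [ b ])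
  desc-∷ʳ d b<S = AllPairs.++⁺ d ([] ∷ []) (All.map (_∷ []) b<S)

  -- Both heads are the maximum of the same entries; different heads would each have to exceed the
  -- other.
  desc-↭⇒≡ : ∀ {xs ys} → Desc xs → Desc ys → xs ↭ ys → xs ≡ ys
  desc-↭⇒≡ {[]} _ _ p = sym (↭-empty-inv (↭-sym p))
  desc-↭⇒≡ {_ ∷ _} {[]} _ _ p = ↭-empty-inv p
  desc-↭⇒≡ {x ∷ xs} {y ∷ ys} (x> ∷ dx) (y> ∷ dy) p
    with ∈-resp-↭ p (here refl) | ∈-resp-↭ (↭-sym p) (here refl)
  ... | here refl | _ = cong (x ∷_) (desc-↭⇒≡ dx dy (drop-∷ p))
  ... | there _ | here refl = cong (x ∷_) (desc-↭⇒≡ dx dy (drop-∷ p))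
  ... | there x∈ | there y∈ = contradiction (All.lookup x> y∈) (<⇒≯ (All.lookup y> x∈))

  -- Generating the 123-avoiding permutations entry by entry.

  above : ℕ → List ℕ → List ℕ
  above b = filter (b <?_)

  down : ℕ → List ℕ
  down = applyDownFrom suc

  down-≤ : ∀ a → All (_≤ a) (down a)
  down-≤ a = All.applyDownFrom⁺₁ suc a id

  down-desc : ∀ a → Desc (down a)
  down-desc a = AllPairs.applyDownFrom⁺₁ suc a λ j<i _ → s≤s j<i

  above-down : ∀ {a b} → a ≤ b → above b (down a) ≡ []
  above-down {a} a≤b = List.filter-none _ (All.map (λ x≤a → ≤⇒≯ (≤-trans x≤a a≤b)) (down-≤ a))

  -- Equivalent to avoiding 123 on words with distinct entries.
  TailsDesc : List ℕ → Set
  TailsDesc []      = ⊤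
  TailsDesc (y ∷ w) = Desc (above y w) × TailsDesc w

  -- The 123-avoiding ways to go on with a permutation whose unused entries are
  -- 1, …, a, all smaller than the ones used, and the entries of the decreasing
  -- list S, all larger than the minimum of the ones used: the latter entries can
  -- only appear in the order of S.  In minFirst the next entry is a left-to-right
  -- minimum and 1, …, a + 1 are unused below.
  mutual
    completions : ℕ → List ℕ → List (List ℕ)
    completions zero    []      = [ [] ]
    completions zero    (s ∷ S) = map (s ∷_) (completions zero S)
    completions (suc a) []      = minFirst a []
    completions (suc a) (s ∷ S) = map (s ∷_) (completions (suc a) S) ++ minFirst a (s ∷ S)

    minFirst : ℕ → List ℕ → List (List ℕ)
    minFirst zero    S = map (1 ∷_) (completions zero S)
    minFirst (suc a) S =
      map (suc (suc a) ∷_) (completions (suc a) S) ++ minFirst a (S ++ [ suc (suc a) ])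

  regroup : ∀ a S → (S ++ [ suc a ]) ++ down a ≡ S ++ down (suc a)
  regroup a S = List.++-assoc S [ suc a ] (down a)

  mutual
    completions-↭ : ∀ a S → All (_↭ S ++ down a) (completions a S)
    completions-↭ zero [] = ↭-refl ∷ []
    completions-↭ zero (s ∷ S) = All.map⁺ (All.map (prep s) (completions-↭ zero S))
    completions-↭ (suc a) [] = minFirst-↭ a []
    completions-↭ (suc a) (s ∷ S) =
      All.++⁺ (All.map⁺ (All.map (prep s) (completions-↭ (suc a) S))) (minFirst-↭ a (s ∷ S))

    minFirst-↭ : ∀ a S → All (_↭ S ++ down (suc a)) (minFirst a S)
    minFirst-↭ zero S = All.map⁺ (All.map (λ p → ↭-trans (prep 1 p) (↭-sym (shift 1 S []))) (completions-↭ zero S))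
    minFirst-↭ (suc a) S = All.++⁺
      (All.map⁺ (All.map (λ p → ↭-trans (prep _ p) (↭-sym (shift _ S _))) (completions-↭ (suc a) S)))
      (All.map (λ p → ↭-trans p (↭-reflexive (regroup (suc a) S))) (minFirst-↭ a (S ++ [ suc (suc a) ])))

  above-∷-cong : ∀ b s w {S} → above b w ≡ above b S → above b (s ∷ w) ≡ above b (s ∷ S)
  -- Both filters branch on the truth value of `b <? s`, which computes to `b <ᵇ s`.
  above-∷-cong b s w eq with b <ᵇ s
  ... | true  = cong (s ∷_) eq
  ... | false = eq

  above-∷ʳ : ∀ {b c} S → c ≤ b → above b (S ++ [ c ]) ≡ above b S
  above-∷ʳ {b} {c} S c≤b = trans (List.filter-++ (b <?_) S [ c ])
    (trans (cong (above b S ++_) (List.filter-reject (b <?_) (≤⇒≯ c≤b))) (List.++-identityʳ _))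

  above-∷ : ∀ {b y w} → y ≤ b → above b (y ∷ w) ≡ above b w
  above-∷ y≤b = List.filter-reject (_ <?_) (≤⇒≯ y≤b)

  mutual
    -- All entries that do not come from `S` are at most `a`, hence dropped, and those of `S` are
    -- placed in the order of `S`. With `b` the entry just placed, this gives both the avoidance of
    -- 123 and the number of larger entries to its right.
    completions-above : ∀ a S {b} → a ≤ b → All (λ w → above b w ≡ above b S) (completions a S)
    completions-above zero [] _ = refl ∷ []
    completions-above zero (s ∷ S) {b} a≤b =
      All.map⁺ (All.map (λ {w} → above-∷-cong b s w) (completions-above zero S a≤b))
    completions-above (suc a) [] a≤b = minFirst-above a [] a≤b
    completions-above (suc a) (s ∷ S) {b} a≤b = All.++⁺
      (All.map⁺ (All.map (λ {w} → above-∷-cong b s w) (completions-above (suc a) S a≤b)))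
      (minFirst-above a (s ∷ S) a≤b)

    minFirst-above : ∀ a S {b} → suc a ≤ b → All (λ w → above b w ≡ above b S) (minFirst a S)
    minFirst-above zero S a<b =
      All.map⁺ (All.map (λ {w} → trans (above-∷ {w = w} a<b)) (completions-above zero S z≤n))
    minFirst-above (suc a) S a<b = All.++⁺
      (All.map⁺ (All.map (λ {w} → trans (above-∷ {w = w} a<b)) (completions-above (suc a) S (<⇒≤ a<b))))
      (All.map (λ e → trans e (above-∷ʳ S a<b)) (minFirst-above a (S ++ [ suc (suc a) ]) (<⇒≤ a<b)))

  above-desc : ∀ {b w S} → Desc S → above b w ≡ above b S → Desc (above b w)
  above-desc {b} d eq = subst Desc (sym eq) (AllPairs.filter⁺ (b <?_) d)

  mutual
    -- By `completions-above`, the larger entries after each placed entry form a filtered copy of a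
    -- decreasing list.
    completions-tailsDesc : ∀ a {S} → Desc S → All (a <_) S → All TailsDesc (completions a S)
    completions-tailsDesc zero [] [] = tt ∷ []
    completions-tailsDesc zero {s ∷ S} (_ ∷ d) (0<s ∷ 0<S) = All.map⁺ (All.zipWith
      (λ {w} (e , t) → above-desc {w = w} d e , t)
      (completions-above zero S z≤n , completions-tailsDesc zero d 0<S))
    completions-tailsDesc (suc a) [] [] = minFirst-tailsDesc a [] []
    completions-tailsDesc (suc a) {s ∷ S} sd@(_ ∷ d) a<sS@(a<s ∷ a<S) = All.++⁺
      (All.map⁺ (All.zipWith (λ {w} (e , t) → above-desc {w = w} d e , t)
        (completions-above (suc a) S (<⇒≤ a<s) , completions-tailsDesc (suc a) d a<S)))
      (minFirst-tailsDesc a sd a<sS)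

    minFirst-tailsDesc : ∀ a {S} → Desc S → All (suc a <_) S → All TailsDesc (minFirst a S)
    minFirst-tailsDesc zero {S} d 1<S = All.map⁺ (All.zipWith
      (λ {w} (e , t) → above-desc {w = w} d e , t)
      (completions-above zero S z≤n , completions-tailsDesc zero d (All.map <⇒≤ 1<S)))
    minFirst-tailsDesc (suc a) {S} d a<S = All.++⁺
      (All.map⁺ (All.zipWith (λ {w} (e , t) → above-desc {w = w} d e , t)
        (completions-above (suc a) S (n≤1+n _) , completions-tailsDesc (suc a) d (All.map <⇒≤ a<S))))
      (minFirst-tailsDesc a (desc-∷ʳ d a<S) (All.++⁺ (All.map <⇒≤ a<S) (n<1+n _ ∷ [])))

  -- No word is generated twice.

  HeadIs≤ : ℕ → List ℕ → Set
  HeadIs≤ b w = ∃₂ λ y v → w ≡ y ∷ v × y ≤ b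

  minFirst-head : ∀ a S → All (HeadIs≤ (suc a)) (minFirst a S)
  minFirst-head zero S = All.map⁺ (All.universal (λ _ → _ , _ , refl , ≤-refl) (completions zero S))
  minFirst-head (suc a) S = All.++⁺
    (All.map⁺ (All.universal (λ _ → _ , _ , refl , ≤-refl) (completions (suc a) S)))
    (All.map (λ (y , v , e , y≤) → y , v , e , m≤n⇒m≤1+n y≤) (minFirst-head a _))

  -- The two branches of the generation are told apart by the first entry: it is `y` in one and at
  -- most `b` in the other.
  map-∷-unique-++ : ∀ {b y L M} → b < y → Unique L → Unique M → All (HeadIs≤ b) M →
                    Unique (map (y ∷_) L ++ M)
  map-∷-unique-++ {b} {y} {L} {M} b<y uL uM heads =
    Unique.++⁺ (Unique.map⁺ List.∷-injectiveʳ uL) uM disjoint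
    where
    disjoint : Disjoint (map (y ∷_) L) M
    disjoint (w∈ , w∈M) with ∈-map⁻ (y ∷_) w∈ | All.lookup heads w∈M
    ... | _ , _ , refl | _ , _ , refl , y≤b = <⇒≱ b<y y≤b

  mutual
    completions-unique : ∀ a {S} → All (a <_) S → Unique (completions a S)
    completions-unique zero [] = [] ∷ []
    completions-unique zero (_ ∷ 0<S) = Unique.map⁺ List.∷-injectiveʳ (completions-unique zero 0<S)
    completions-unique (suc a) [] = minFirst-unique a []
    completions-unique (suc a) (a<s ∷ a<S) = map-∷-unique-++ a<s
      (completions-unique (suc a) a<S) (minFirst-unique a (a<s ∷ a<S)) (minFirst-head a _)

    minFirst-unique : ∀ a {S} → All (suc a <_) S → Unique (minFirst a S)
    minFirst-unique zero 1<S =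
      Unique.map⁺ List.∷-injectiveʳ (completions-unique zero (All.map <⇒≤ 1<S))
    minFirst-unique (suc a) a<S = map-∷-unique-++ (n<1+n _)
      (completions-unique (suc a) (All.map <⇒≤ a<S))
      (minFirst-unique a (All.++⁺ (All.map <⇒≤ a<S) (n<1+n _ ∷ [])))
      (minFirst-head a _)

  -- Every 123-avoiding word is generated.

  above-↭ : ∀ {a b S w} → w ↭ S ++ down a → a ≤ b → All (b <_) S → above b w ↭ S
  above-↭ {a} {b} {S} p a≤b b<S = ↭-trans (filter-↭ (b <?_) p) (↭-reflexive (trans
    (List.filter-++ (b <?_) S (down a))
    (trans (cong₂ _++_ (List.filter-all (b <?_) b<S) (above-down a≤b)) (List.++-identityʳ S))))

  mutual
    completions-complete : ∀ a {b S w} → a ≤ b → All (b <_) S → Desc S →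
      w ↭ S ++ down a → above b w ≡ S → TailsDesc w → w ∈ completions a S
    completions-complete zero {S = []} {[]} _ _ _ _ _ _ = here refl
    completions-complete zero {S = s ∷ S} {[]} _ _ _ p _ _ = case ↭-empty-inv (↭-sym p) of λ ()
    completions-complete (suc a) {S = S} {[]} _ _ _ p _ _
      with () ← ∈-resp-↭ (↭-sym p) (∈-++⁺ʳ S (here refl))
    completions-complete a {b} {S} {y ∷ w} a≤b b<S d p e t with b <? y
    completions-complete a {b} {S} {y ∷ w} a≤b b<S d p e t | yes b<y
      -- As `y` survives the filter, `e` makes it the head of `S`, and the tail of `S` becomes
      -- `above b w`.
      with trans (sym e) (List.filter-accept (b <?_) b<y)
    completions-complete zero {b} {_} {y ∷ w} a≤b (_ ∷ b<S) (_ ∷ d) p e (_ , t) | yes b<y | refl =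
      ∈-map⁺ (y ∷_) (completions-complete zero a≤b b<S d (drop-∷ p) refl t)
    completions-complete (suc a) {b} {_} {y ∷ w} a≤b (_ ∷ b<S) (_ ∷ d) p e (_ , t) | yes b<y | refl =
      ∈-++⁺ˡ (∈-map⁺ (y ∷_) (completions-complete (suc a) a≤b b<S d (drop-∷ p) refl t))
    completions-complete a {b} {S} {y ∷ w} a≤b b<S d p e t | no b≮y
      with ∈-++⁻ S (∈-resp-↭ p (here refl))
    ... | inj₁ y∈S = contradiction (All.lookup b<S y∈S) b≮y
    completions-complete (suc a) {b} {[]} {y ∷ w} a≤b b<S d p e t | no b≮y | inj₂ y∈ =
      minFirst-complete a (All.lookup (down-≤ (suc a)) y∈) [] d p t
    completions-complete (suc a) {b} {s ∷ S} {y ∷ w} a≤b b<S d p e t | no b≮y | inj₂ y∈ =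
      ∈-++⁺ʳ _ (minFirst-complete a (All.lookup (down-≤ (suc a)) y∈)
        (All.map (≤-trans (s≤s a≤b)) b<S) d p t)

    -- If `y` is `suc a`, then `above y w` and `S` are decreasing lists of the same entries, hence
    -- equal: this is where avoidance fixes the order of the later entries. If `y` is smaller,
    -- `suc a` exceeds the new minimum and joins `S` as its least entry.
    minFirst-complete : ∀ a {S y w} → y ≤ suc a → All (suc a <_) S → Desc S →
      y ∷ w ↭ S ++ down (suc a) → TailsDesc (y ∷ w) → y ∷ w ∈ minFirst a S
    minFirst-complete a {S} {y} {w} y≤ a<S d p (dy , t) with y ≟ suc a
    minFirst-complete zero {S} {y} {w} y≤ a<S d p (dy , t) | yes refl =
      ∈-map⁺ (1 ∷_) (completions-complete zero z≤n a<S d (drop-mid [] S p)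
        (desc-↭⇒≡ dy d (above-↭ (drop-mid [] S p) z≤n a<S)) t)
    minFirst-complete (suc a) {S} {y} {w} y≤ a<S d p (dy , t) | yes refl =
      ∈-++⁺ˡ (∈-map⁺ (_ ∷_) (completions-complete (suc a) (n≤1+n _) a<S d (drop-mid [] S p)
        (desc-↭⇒≡ dy d (above-↭ (drop-mid [] S p) (n≤1+n _) a<S)) t))
    minFirst-complete zero {S} y≤ a<S d p t | no y≢ =
      case ∈-++⁻ S (∈-resp-↭ p (here refl)) of λ where
        (inj₁ y∈S) → contradiction y≤ (<⇒≱ (All.lookup a<S y∈S))
        (inj₂ (here y≡1)) → contradiction y≡1 y≢
    minFirst-complete (suc a) {S} y≤ a<S d p t | no y≢ =
      ∈-++⁺ʳ _ (minFirst-complete a (≤-pred (≤∧≢⇒< y≤ y≢))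
        (All.++⁺ (All.map <⇒≤ a<S) (n<1+n _ ∷ [])) (desc-∷ʳ d a<S)
        (↭-trans p (↭-reflexive (sym (regroup (suc a) S)))) t)

  -- Relative order, and the shape of occurrences of 1j⋯2.

  rank : List ℕ → ℕ → ℕ
  rank w x = length (filter (_≤? x) w)

  rank-mono-≤ : ∀ w {x y} → x ≤ y → rank w x ≤ rank w y
  rank-mono-≤ [] _ = z≤n
  rank-mono-≤ (z ∷ w) {x} {y} x≤y with z ≤? x | z ≤? y
  ... | yes z≤x | _ rewrite List.filter-accept (_≤? x) {xs = w} z≤x
                          | List.filter-accept (_≤? y) {xs = w} (≤-trans z≤x x≤y)
                          = s≤s (rank-mono-≤ w x≤y)
  ... | no z≰x | yes z≤y rewrite List.filter-reject (_≤? x) {xs = w} z≰x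
                               | List.filter-accept (_≤? y) {xs = w} z≤y
                               = m≤n⇒m≤1+n (rank-mono-≤ w x≤y)
  ... | no z≰x | no z≰y rewrite List.filter-reject (_≤? x) {xs = w} z≰x
                              | List.filter-reject (_≤? y) {xs = w} z≰y
                              = rank-mono-≤ w x≤y

  rank-cancel-< : ∀ w {x y} → rank w x < rank w y → x < y
  rank-cancel-< w lt = ≰⇒> (<⇒≱ lt ∘ rank-mono-≤ w)

  rank-≤ : ∀ {x y w} → x ≤ y → rank (x ∷ w) y ≡ suc (rank w y)
  rank-≤ {y = y} x≤y = cong length (List.filter-accept (_≤? y) x≤y)

  rank-> : ∀ {x y w} → y < x → rank (x ∷ w) y ≡ rank w y
  rank-> {y = y} y<x = cong length (List.filter-reject (_≤? y) (<⇒≱ y<x))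

  rank-max : ∀ {x w} → All (_≤ x) w → rank w x ≡ length w
  rank-max {x} w≤x = cong length (List.filter-all (_≤? x) w≤x)

  rank-min : ∀ {x w} → All (x <_) w → rank w x ≡ 0
  rank-min {x} x<w = cong length (List.filter-none (_≤? x) (All.map <⇒≱ x<w))

  red-desc : ∀ {u} → Desc u → red u ≡ down (length u)
  red-desc [] = refl
  red-desc {y ∷ v} (y>v ∷ d) = cong₂ _∷_
    (trans (rank-≤ {w = v} ≤-refl) (cong suc (rank-max (All.map <⇒≤ y>v))))
    (trans (List.map-cong-local (All.map (rank-> {w = v}) y>v)) (red-desc d))

  -- The condition for `x ∷ u` to be order-isomorphic to 1j⋯2, with `x` as the 1, stated without
  -- ranks so that it can be followed along a recursion on `u`.
  IsPeak : ℕ → List ℕ → Set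
  IsPeak x u = All (x <_) u × Desc u

  isPeak? : ∀ x → Decidable (IsPeak x)
  isPeak? x u = All.all? (x <?_) u ×-dec AllPairs.allPairs? _>?_ u

  pattern1↓-suc : ∀ k → pattern1↓ (suc k) ≡ 1 ∷ applyDownFrom (λ i → suc (suc i)) k
  pattern1↓-suc k = cong (1 ∷_) (List.reverse-applyUpTo (2 +_) k)

  isPeak⇒red : ∀ {x u} → IsPeak x u → red (x ∷ u) ≡ pattern1↓ (suc (length u))
  isPeak⇒red {x} {u} (x<u , d) = trans
    (cong₂ _∷_
      (trans (rank-≤ {w = u} ≤-refl) (cong suc (rank-min x<u)))
      (trans (List.map-cong-local (All.map (rank-≤ {w = u} ∘ <⇒≤) x<u))
      (trans (List.map-∘ u)
      (trans (cong (map suc) (red-desc d)) (List.map-applyDownFrom suc suc (length u))))))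
    (sym (pattern1↓-suc (length u)))

  -- Ranks in a fixed word reflect strict inequalities, so those between the entries of the pattern
  -- carry over to `x ∷ u`.
  red⇒isPeak : ∀ {x u k} → red (x ∷ u) ≡ pattern1↓ (suc k) → IsPeak x u
  red⇒isPeak {x} {u} {k} eq =
    All.map (rank-cancel-< (x ∷ u)) (All.map⁻ (subst (All (_ <_)) (sym tail≡) minimal)) ,
    AllPairs.map (rank-cancel-< (x ∷ u)) (AllPairs.map⁻ (subst Desc (sym tail≡)
      (AllPairs.applyDownFrom⁺₁ _ k λ j<i _ → s≤s (s≤s j<i))))
    where
    eq′ = trans eq (pattern1↓-suc k)
    tail≡ = List.∷-injectiveʳ eq′
    minimal = subst (λ r → All (r <_) (applyDownFrom (λ i → suc (suc i)) k)) (sym (List.∷-injectiveˡ eq′))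
      (All.applyDownFrom⁺₂ _ k λ i → s≤s (s≤s z≤n))

  -- Counting the occurrences of 1j⋯2.

  module _ {a p} {A : Set a} {P : Pred A p} (P? : Decidable P) where

    count : List A → ℕ
    count = length ∘ filter P?

    count-++ : ∀ us vs → count (us ++ vs) ≡ count us + count vs
    count-++ us vs = trans (cong length (List.filter-++ P? us vs)) (List.length-++ (filter P? us))

    count-none : ∀ {us} → All (¬_ ∘ P) us → count us ≡ 0
    count-none = cong length ∘ List.filter-none P?

    count≡0⇒none : ∀ {us} → count us ≡ 0 → All (¬_ ∘ P) us
    count≡0⇒none eq = All.¬Any⇒All¬ _ λ any → <⇒≢ (List.filter-some P? any) (sym eq)

    count-cong : ∀ {q} {Q : Pred A q} (Q? : Decidable Q) {us} →
                 All (λ u → (P u → Q u) × (Q u → P u)) us → count us ≡ length (filter Q? us)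
    count-cong Q? [] = refl
    count-cong Q? {u ∷ us} ((to , from) ∷ es) with P? u
    ... | yes Pu rewrite List.filter-accept Q? {xs = us} (to Pu) = cong suc (count-cong Q? es)
    ... | no ¬Pu rewrite List.filter-reject Q? {xs = us} (¬Pu ∘ from) = count-cong Q? es

    count-map : ∀ {b} {B : Set b} (f : B → A) us → count (map f us) ≡ length (filter (P? ∘ f) us)
    count-map f [] = refl
    count-map f (u ∷ us) with P? (f u)
    ... | yes _ = cong suc (count-map f us)
    ... | no _  = count-map f us

  subsequences-length : ∀ k w → All (λ u → length u ≡ k) (subsequences k w)
  subsequences-length zero w = refl ∷ []
  subsequences-length (suc k) [] = []
  subsequences-length (suc k) (x ∷ w) =
    All.++⁺ (All.map⁺ (All.map (cong suc) (subsequences-length k w))) (subsequences-length (suc k) w)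

  subsequences-All : ∀ {p} {P : Pred ℕ p} k {w} → All P w → All (All P) (subsequences k w)
  subsequences-All zero _ = [] ∷ []
  subsequences-All (suc k) [] = []
  subsequences-All (suc k) (px ∷ pw) =
    All.++⁺ (All.map⁺ (All.map (px ∷_) (subsequences-All k pw))) (subsequences-All (suc k) pw)

  -- Any `k` of the entries above `x` are already in decreasing order, so only their choice counts.
  -- The induction distinguishes whether `y` is chosen, which is Pascal's rule.
  count-peaks : ∀ k x w → Desc (above x w) →
                count (isPeak? x) (subsequences k w) ≡ length (above x w) C k
  count-peaks zero x w _ = refl
  count-peaks (suc k) x [] _ = sym (k>n⇒nCk≡0 {0} {suc k} (s≤s z≤n))
  count-peaks (suc k) x (y ∷ w) d with x <? y
  ... | no x≮y = begin
    count (isPeak? x) (map (y ∷_) (subsequences k w) ++ subsequences (suc k) w)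
      ≡⟨ count-++ (isPeak? x) (map (y ∷_) (subsequences k w)) _ ⟩
    count (isPeak? x) (map (y ∷_) (subsequences k w)) + count (isPeak? x) (subsequences (suc k) w)
      ≡⟨ cong₂ _+_
           (count-none (isPeak? x) (All.map⁺ (All.universal
             (λ { _ (x<y ∷ _ , _) → x≮y x<y }) (subsequences k w))))
           (count-peaks (suc k) x w (subst Desc drop-y d)) ⟩
    length (above x w) C suc k
      ≡⟨ cong (λ l → length l C suc k) (sym drop-y) ⟩
    length (above x (y ∷ w)) C suc k ∎
    where
    open ≡-Reasoning
    drop-y = List.filter-reject (x <?_) {xs = w} x≮y
  ... | yes x<y with y> ∷ d′ ← subst Desc (List.filter-accept (x <?_) {xs = w} x<y) d = begin
    count (isPeak? x) (map (y ∷_) (subsequences k w) ++ subsequences (suc k) w)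
      ≡⟨ count-++ (isPeak? x) (map (y ∷_) (subsequences k w)) _ ⟩
    count (isPeak? x) (map (y ∷_) (subsequences k w)) + count (isPeak? x) (subsequences (suc k) w)
      ≡⟨ cong₂ _+_
           (trans (count-map (isPeak? x) (y ∷_) (subsequences k w))
           -- Putting `y` in front keeps a peak a peak, because `y` exceeds every later entry above
           -- `x`.
           (trans (count-cong (isPeak? x ∘ (y ∷_)) (isPeak? x)
                    (All.map (λ below → (λ { (_ ∷ x<u , _ ∷ du) → x<u , du }) ,
                                        (λ { (x<u , du) → x<y ∷ x<u ,
                                                            All.zipWith (λ (f , lt) → f lt) (below , x<u) ∷ du }))
                      (subsequences-All k (All.tabulate λ z∈ x<z → All.lookup y> (∈-filter⁺ (x <?_) z∈ x<z)))))
                  (count-peaks k x w d′)))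
           (count-peaks (suc k) x w d′) ⟩
    length (above x w) C k + length (above x w) C suc k
      ≡⟨ nCk+nC[k+1]≡[n+1]C[k+1] (length (above x w)) k ⟩
    suc (length (above x w)) C suc k
      ≡⟨ cong (λ l → length l C suc k) (sym (List.filter-accept (x <?_) {xs = w} x<y)) ⟩
    length (above x (y ∷ w)) C suc k ∎
    where open ≡-Reasoning

  -- An occurrence that uses `y` has it in first position, so `y` plays the 1 and the rest is a peak
  -- over `y`.
  occr-pattern1↓-∷ : ∀ k y w → Desc (above y w) →
    occr (pattern1↓ (suc k)) (y ∷ w) ≡ length (above y w) C k + occr (pattern1↓ (suc k)) w
  occr-pattern1↓-∷ k y w d = begin
    count isτ? (map (y ∷_) (subsequences l w) ++ subsequences (suc l) w)
      ≡⟨ count-++ isτ? (map (y ∷_) (subsequences l w)) _ ⟩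
    count isτ? (map (y ∷_) (subsequences l w)) + occr τ w
      ≡⟨ cong (_+ occr τ w) (count-map isτ? (y ∷_) (subsequences l w)) ⟩
    count (isτ? ∘ (y ∷_)) (subsequences l w) + occr τ w
      ≡⟨ cong (_+ occr τ w) (count-cong (isτ? ∘ (y ∷_)) (isPeak? y)
           (All.map
             (λ e → red⇒isPeak {k = k} ,
                    λ pk → trans (isPeak⇒red pk) (cong (pattern1↓ ∘ suc) (trans e l≡k)))
             (subsequences-length l w))) ⟩
    count (isPeak? y) (subsequences l w) + occr τ w
      ≡⟨ cong (_+ occr τ w) (count-peaks l y w d) ⟩
    length (above y w) C l + occr τ w
      ≡⟨ cong (λ i → length (above y w) C i + occr τ w) l≡k ⟩
    length (above y w) C k + occr τ w ∎
    where
    open ≡-Reasoning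
    τ = pattern1↓ (suc k)
    -- This is the length that `occr` computes from the pattern, without the leading 1; it equals
    -- `k` only up to a proof.
    l = length (reverse (range 2 (suc k)))
    isτ? = λ u → List.≡-dec _≟_ (red u) τ
    l≡k : l ≡ k
    l≡k = trans (List.length-reverse (range 2 (suc k))) (List.length-applyUpTo (2 +_) k)

  -- Avoidance of 123 as a condition on the entries after each entry.

  123ᵖ : List ℕ
  123ᵖ = 1 ∷ 2 ∷ 3 ∷ []

  subsequences1-All⁻ : ∀ {p} {P : Pred (List ℕ) p} w → All P (subsequences 1 w) → All (P ∘ [_]) w
  subsequences1-All⁻ [] [] = []
  subsequences1-All⁻ (x ∷ w) (px ∷ pw) = px ∷ subsequences1-All⁻ w pw

  subsequences1-All⁺ : ∀ {p} {P : Pred (List ℕ) p} {w} → All (P ∘ [_]) w → All P (subsequences 1 w)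
  subsequences1-All⁺ [] = []
  subsequences1-All⁺ (px ∷ pw) = px ∷ subsequences1-All⁺ pw

  subsequences2-All⁻ : ∀ {p} {P : Pred (List ℕ) p} w → All P (subsequences 2 w) →
                       AllPairs (λ a b → P (a ∷ b ∷ [])) w
  subsequences2-All⁻ [] [] = []
  subsequences2-All⁻ (x ∷ w) pw with l , r ← All.++⁻ (map (x ∷_) (subsequences 1 w)) pw =
    subsequences1-All⁻ w (All.map⁻ l) ∷ subsequences2-All⁻ w r

  subsequences2-All⁺ : ∀ {p} {P : Pred (List ℕ) p} {w} →
                       AllPairs (λ a b → P (a ∷ b ∷ [])) w → All P (subsequences 2 w)
  subsequences2-All⁺ [] = []
  subsequences2-All⁺ (px ∷ pw) = All.++⁺ (All.map⁺ (subsequences1-All⁺ px)) (subsequences2-All⁺ pw)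

  red≡123⇒ : ∀ y a b → red (y ∷ a ∷ b ∷ []) ≡ 123ᵖ → y < a × a < b
  red≡123⇒ y a b eq = rank-cancel-< w y<a , rank-cancel-< w a<b
    where
    w = y ∷ a ∷ b ∷ []
    ry : rank w y ≡ 1
    ry = List.∷-injectiveˡ eq
    ra : rank w a ≡ 2
    ra = List.∷-injectiveˡ (List.∷-injectiveʳ eq)
    rb : rank w b ≡ 3
    rb = List.∷-injectiveˡ (List.∷-injectiveʳ (List.∷-injectiveʳ eq))
    y<a : rank w y < rank w a
    y<a rewrite ry | ra = ≤-refl
    a<b : rank w a < rank w b
    a<b rewrite ra | rb = ≤-refl

  ⇒red≡123 : ∀ {y a b} → y < a → a < b → red (y ∷ a ∷ b ∷ []) ≡ 123ᵖ
  ⇒red≡123 {y} {a} {b} y<a a<b = cong₂ _∷_ ry (cong₂ _∷_ ra (cong [_] rb))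
    where
    y<b = <-trans y<a a<b
    ry : rank (y ∷ a ∷ b ∷ []) y ≡ 1
    ry = trans (rank-≤ {w = a ∷ b ∷ []} ≤-refl) (cong suc (rank-min (y<a ∷ y<b ∷ [])))
    ra : rank (y ∷ a ∷ b ∷ []) a ≡ 2
    ra = trans (rank-≤ {w = a ∷ b ∷ []} (<⇒≤ y<a)) (cong suc
           (trans (rank-≤ {w = [ b ]} ≤-refl) (cong suc (rank-min (a<b ∷ [])))))
    rb : rank (y ∷ a ∷ b ∷ []) b ≡ 3
    rb = rank-max (<⇒≤ y<b ∷ <⇒≤ a<b ∷ ≤-refl ∷ [])

  above-desc⇒no123 : ∀ y w → Desc (above y w) → AllPairs (λ a b → red (y ∷ a ∷ b ∷ []) ≢ 123ᵖ) w
  above-desc⇒no123 y [] _ = []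
  above-desc⇒no123 y (a ∷ w) d with y <? a
  ... | no y≮a = All.universal (λ b e → y≮a (proj₁ (red≡123⇒ y a b e))) w
               ∷ above-desc⇒no123 y w (subst Desc (List.filter-reject (y <?_) {xs = w} y≮a) d)
  ... | yes y<a with a> ∷ d′ ← subst Desc (List.filter-accept (y <?_) {xs = w} y<a) d =
    All.tabulate (λ {b} b∈ e → let y<a , a<b = red≡123⇒ y a b e in
      <⇒≯ a<b (All.lookup a> (∈-filter⁺ (y <?_) b∈ (<-trans y<a a<b))))
    ∷ above-desc⇒no123 y w d′

  no123⇒above-desc : ∀ y {w} → Unique w →
                     AllPairs (λ a b → red (y ∷ a ∷ b ∷ []) ≢ 123ᵖ) w →
                     Desc (above y w)
  no123⇒above-desc y {w} u av = restrict (All.all-filter (y <?_) w)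
    (AllPairs.filter⁺ (y <?_) (AllPairs.zipWith
      -- Avoidance only excludes `a < b`; distinctness of the entries improves this to `b < a`. The
      -- premise `y < a` is discharged after filtering, by `restrict`.
      (λ (a≢b , n) y<a → ≤∧≢⇒< (≮⇒≥ (n ∘ ⇒red≡123 y<a)) (a≢b ∘ sym)) (u , av)))
    where
    restrict : ∀ {v} → All (y <_) v → AllPairs (λ a b → y < a → b < a) v → Desc v
    restrict [] [] = []
    restrict (y<a ∷ y<v) (f ∷ fs) = All.map (λ g → g y<a) f ∷ restrict y<v fs

  tailsDesc⇒no123 : ∀ w → TailsDesc w → All (λ u → red u ≢ 123ᵖ) (subsequences 3 w)
  tailsDesc⇒no123 [] _ = []
  tailsDesc⇒no123 (y ∷ w) (d , t) = All.++⁺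
    (All.map⁺ (subsequences2-All⁺ (above-desc⇒no123 y w d))) (tailsDesc⇒no123 w t)

  no123⇒tailsDesc : ∀ {w} → Unique w → All (λ u → red u ≢ 123ᵖ) (subsequences 3 w) → TailsDesc w
  no123⇒tailsDesc [] _ = tt
  no123⇒tailsDesc {y ∷ w} (_ ∷ u) av with l , r ← All.++⁻ (map (y ∷_) (subsequences 2 w)) av =
    no123⇒above-desc y u (subsequences2-All⁻ w (All.map⁻ l)) , no123⇒tailsDesc u r

  is123? : Decidable (λ u → red u ≡ 123ᵖ)
  is123? u = List.≡-dec _≟_ (red u) 123ᵖ

  -- Matching `perms123` with the generated words.

  words⇒ : ∀ A k {w} → w ∈ words A k → w ⊆ A × length w ≡ k
  words⇒ A zero (here refl) = (λ ()) , refl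
  words⇒ A (suc k) w∈ with ∈-cartesianProductWith⁻ _∷_ A (words A k) w∈
  ... | x , v , x∈ , v∈ , refl with sub , len ← words⇒ A k v∈ =
    (λ { (here refl) → x∈ ; (there y∈) → sub y∈ }) , cong suc len

  ⇒words : ∀ A {w} → w ⊆ A → w ∈ words A (length w)
  ⇒words A {[]} _ = here refl
  ⇒words A {x ∷ w} sub = ∈-cartesianProductWith⁺ _∷_ (sub (here refl)) (⇒words A (sub ∘ there))

  words-unique : ∀ {A} → Unique A → ∀ k → Unique (words A k)
  words-unique u zero = [] ∷ []
  words-unique u (suc k) = Unique.cartesianProductWith⁺ _∷_ List.∷-injective u (words-unique u k)

  range↭down : ∀ n → range 1 n ↭ down n
  range↭down n = ↭-trans (↭-sym (↭-reverse (range 1 n))) (↭-reflexive (List.reverse-applyUpTo suc n))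

  ↭-unique : ∀ {v w : List ℕ} → v ↭ w → Unique v → Unique w
  ↭-unique p = ↭ₛ.Unique-resp-↭ (setoid ℕ) (↭⇒↭ₛ p)

  range-unique : ∀ n → Unique (range 1 n)
  range-unique n = ↭-unique (↭-sym (range↭down n)) (desc-unique (down-desc n))

  perms123-unique : ∀ n → Unique (perms123 n)
  perms123-unique n = Unique.filter⁺ _ (Unique.filter⁺ (unique? _≟_) (words-unique (range-unique n) n))

  perms123⇒completions : ∀ n {σ} → σ ∈ perms123 n → σ ∈ completions n []
  perms123⇒completions n {σ} σ∈
    with σ∈perms , occr≡0 ← ∈-filter⁻ (λ σ → occr 123ᵖ σ ≟ 0) {xs = perms n} σ∈
    with σ∈words , u ← ∈-filter⁻ (unique? _≟_) {xs = words (range 1 n) n} σ∈perms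
    with sub , len ← words⇒ (range 1 n) n σ∈words =
    -- Before anything is placed, `n` itself serves as the bound: no entry exceeds it, in accordance
    -- with the empty `S`.
    completions-complete n ≤-refl [] [] p (↭-empty-inv (above-↭ p ≤-refl []))
      (no123⇒tailsDesc u (count≡0⇒none is123? occr≡0))
    where
    p : σ ↭ down n
    -- A word of `n` distinct letters over an alphabet of `n` letters uses each of them once.
    p = ↭-trans (unique-⊆-length⇒↭ u sub (trans (List.length-applyUpTo suc n) (sym len))) (range↭down n)

  completions⇒perms123 : ∀ n {σ} → σ ∈ completions n [] → σ ∈ perms123 n
  completions⇒perms123 n {σ} σ∈ = ∈-filter⁺ (λ σ → occr 123ᵖ σ ≟ 0)
    (∈-filter⁺ (unique? _≟_)
      (subst (λ k → σ ∈ words (range 1 n) k) (trans (↭-length p) (List.length-applyUpTo suc n))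
        (⇒words (range 1 n) (∈-resp-↭ p)))
      (↭-unique (↭-sym p) (range-unique n)))
    (count-none is123? (tailsDesc⇒no123 σ (All.lookup (completions-tailsDesc n [] []) σ∈)))
    where
    p : σ ↭ range 1 n
    p = ↭-trans (All.lookup (completions-↭ n []) σ∈) (↭-sym (range↭down n))

  perms123↭completions : ∀ n → perms123 n ↭ completions n []
  perms123↭completions n = unique-⇔⇒↭ (perms123-unique n) (completions-unique n [])
    (perms123⇒completions n) (completions⇒perms123 n)

  -- Left-to-right minima of a suffix.

  IsLRminBelow : ℕ → (σ : List ℕ) → Fin (length σ) → Set
  IsLRminBelow m σ j = IsLRmin σ j × lookup σ j < m

  isLRminBelow? : ∀ m σ → Decidable (IsLRminBelow m σ)
  isLRminBelow? m σ j = isLRmin? σ j ×-dec (lookup σ j <? m)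

  -- If `σ` is a suffix and `m` the minimum of the entries before it, this counts the left-to-right
  -- minima of the whole word that lie in `σ`.
  LRminBelow : ℕ → List ℕ → ℕ
  LRminBelow m σ = count (isLRminBelow? m σ) (allFin (length σ))

  LRmin≡LRminBelow : ∀ {m} σ → All (_< m) σ → LRmin σ ≡ LRminBelow m σ
  LRmin≡LRminBelow {m} σ σ<m = count-cong (isLRmin? σ) (isLRminBelow? m σ)
    (All.universal (λ j → (λ min → min , All.lookup σ<m (∈-lookup j)) , proj₁) (allFin (length σ)))

  module _ {m y : ℕ} {w : List ℕ} where

    private
      -- Covers both cases below: the two hypotheses let `m′` act as the smaller of `m` and `y`, the
      -- bound once `y` has been read.
      LRminBelow-tail : ∀ m′ →
        (∀ j → IsLRminBelow m (y ∷ w) (Fin.suc j) → lookup w j < m′) →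
        (∀ j → lookup w j < m′ → lookup w j < y × lookup w j < m) →
        count (isLRminBelow? m (y ∷ w)) (tabulate Fin.suc) ≡ LRminBelow m′ w
      LRminBelow-tail m′ to from =
        trans (cong (count (isLRminBelow? m (y ∷ w))) (sym (List.map-tabulate id Fin.suc)))
        (trans (count-map (isLRminBelow? m (y ∷ w)) Fin.suc (allFin (length w)))
        (count-cong (isLRminBelow? m (y ∷ w) ∘ Fin.suc) (isLRminBelow? m′ w) (All.universal
          (λ j → (λ below → (λ i i<j → proj₁ below (Fin.suc i) (s≤s i<j)) , to j below) ,
                 (λ (min , lt) → (λ { Fin.zero _ → proj₁ (from j lt)
                                    ; (Fin.suc i) (s≤s i<j) → min i i<j }) , proj₂ (from j lt)))
          (allFin (length w)))))

    LRminBelow-min : y < m → LRminBelow m (y ∷ w) ≡ suc (LRminBelow y w)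
    LRminBelow-min y<m = trans
      (cong length (List.filter-accept (isLRminBelow? m (y ∷ w))
        {x = Fin.zero} {xs = tabulate Fin.suc} ((λ _ ()) , y<m)))
      (cong suc (LRminBelow-tail y
        (λ j (min , _) → min Fin.zero (s≤s z≤n))
        (λ j lt → lt , <-trans lt y<m)))

    LRminBelow-nonMin : m ≤ y → LRminBelow m (y ∷ w) ≡ LRminBelow m w
    LRminBelow-nonMin m≤y = trans
      (cong length (List.filter-reject (isLRminBelow? m (y ∷ w))
        {x = Fin.zero} {xs = tabulate Fin.suc} (≤⇒≯ m≤y ∘ proj₂)))
      (LRminBelow-tail m (λ j → proj₂) (λ j lt → <-≤-trans lt m≤y , lt))

open Combinatorics

module _ {c ℓ} (R : CommutativeRing c ℓ) where

  open CommutativeRing R hiding (zero)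
  open GeneratingFunctions R
  open import Algebra.Properties.Semiring.Exp semiring using (_^_; ^-congʳ; ^-homo-*)
  open Exp commutativeSemiring using (^-distrib-*)
  open import Relation.Binary.Reasoning.Setoid setoid
  open CommutativeSemigroup +-commutativeSemigroup using () renaming (interchange to +-interchange)
  open CommutativeSemigroup *-commutativeSemigroup using () renaming (interchange to *-interchange)

  -- Finite sums.

  module _ {a} {A : Set a} where

    sum-++ : ∀ (us vs : List A) f → sum (us ++ vs) f ≈ sum us f + sum vs f
    sum-++ [] vs f = sym (+-identityˡ _)
    sum-++ (u ∷ us) vs f = trans (+-congˡ (sum-++ us vs f)) (sym (+-assoc _ _ _))

    sum-cong : ∀ {us : List A} {f g} → All (λ u → f u ≈ g u) us → sum us f ≈ sum us g
    sum-cong [] = refl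
    sum-cong (e ∷ es) = +-cong e (sum-cong es)

    sum-⊕ : ∀ (us : List A) f g → sum us (λ u → f u + g u) ≈ sum us f + sum us g
    sum-⊕ [] f g = sym (+-identityˡ 0#)
    sum-⊕ (u ∷ us) f g = trans (+-congˡ (sum-⊕ us f g)) (+-interchange _ _ _ _)

    sum-*ˡ : ∀ (us : List A) b f → sum us (λ u → b * f u) ≈ b * sum us f
    sum-*ˡ [] b f = sym (zeroʳ b)
    sum-*ˡ (u ∷ us) b f = trans (+-congˡ (sum-*ˡ us b f)) (sym (distribˡ b _ _))

    sum-↭ : ∀ {us vs : List A} f → us ↭ vs → sum us f ≈ sum vs f
    sum-↭ f Perm.refl = refl
    sum-↭ f (Perm.prep u p) = +-congˡ (sum-↭ f p)
    sum-↭ f (Perm.swap {xs = us} {ys = vs} u v p) = begin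
      f u + (f v + sum us f)  ≈⟨ +-assoc _ _ _ ⟨
      f u + f v + sum us f    ≈⟨ +-cong (+-comm _ _) (sum-↭ f p) ⟩
      f v + f u + sum vs f    ≈⟨ +-assoc _ _ _ ⟩
      f v + (f u + sum vs f)  ∎
    sum-↭ f (Perm.trans p q) = trans (sum-↭ f p) (sum-↭ f q)

    sum-map : ∀ {b} {B : Set b} (h : B → A) us f → sum (map h us) f ≈ sum us (f ∘ h)
    sum-map h [] f = refl
    sum-map h (u ∷ us) f = +-congˡ (sum-map h us f)

  sum-applyUpTo-cong : ∀ (h h′ : ℕ → ℕ) {f g} n → (∀ i → f (h i) ≈ g (h′ i)) →
                       sum (applyUpTo h n) f ≈ sum (applyUpTo h′ n) g
  sum-applyUpTo-cong h h′ zero e = refl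
  sum-applyUpTo-cong h h′ (suc n) e = +-cong (e 0) (sum-applyUpTo-cong (h ∘ suc) (h′ ∘ suc) n (e ∘ suc))

  -- Products of power series.

  ⊛-0 : ∀ f g → (f ⊛ g) 0 ≈ f 0 * g 0
  ⊛-0 f g = +-identityʳ _

  ⊛-suc : ∀ f g n → (f ⊛ g) (suc n) ≈ f 0 * g (suc n) + ((f ∘ suc) ⊛ g) n
  ⊛-suc f g n = +-congˡ (sum-applyUpTo-cong suc id (suc n) λ _ → refl)

  -- The terms with `i` at least 1 are reindexed by `k = i + 1`, the index of the recurrence.
  ⊛-head : ∀ f g n → (f ⊛ g) n ≈ f 0 * g n + sum (range 2 (suc n)) (λ k → f (k ∸ 1) * g (suc n ∸ k))
  ⊛-head f g n = +-congˡ (sum-applyUpTo-cong suc (λ i → suc (suc i)) n λ _ → refl)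

  ⊛-congʳ : ∀ {f f′} g → f ≈ₛ f′ → f ⊛ g ≈ₛ f′ ⊛ g
  ⊛-congʳ g e n = sum-cong (All.universal (λ i → *-congʳ (e i)) (range 0 n))

  ⊛-distribʳ : ∀ f f′ g → (f ⊕ f′) ⊛ g ≈ₛ f ⊛ g ⊕ f′ ⊛ g
  ⊛-distribʳ f f′ g n = trans
    (sum-cong (All.universal (λ i → distribʳ _ _ _) (range 0 n))) (sum-⊕ (range 0 n) _ _)

  ⊛-scale : ∀ b f g n → ((λ i → b * f i) ⊛ g) n ≈ b * (f ⊛ g) n
  ⊛-scale b f g n = trans
    (sum-cong (All.universal (λ i → *-assoc _ _ _) (range 0 n))) (sum-*ˡ (range 0 n) b _)

  zero-⊛ : ∀ g → (λ _ → 0#) ⊛ g ≈ₛ λ _ → 0#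
  zero-⊛ g n = begin
    sum (range 0 n) (λ i → 0# * g (n ∸ i))  ≈⟨ sum-*ˡ (range 0 n) 0# _ ⟩
    0# * sum (range 0 n) (λ i → g (n ∸ i))  ≈⟨ zeroˡ _ ⟩
    0#                                      ∎

  const-⊛ : ∀ b g n → (const b ⊛ g) n ≈ b * g n
  const-⊛ b g zero = ⊛-0 (const b) g
  const-⊛ b g (suc n) = begin
    (const b ⊛ g) (suc n)                  ≈⟨ ⊛-suc (const b) g n ⟩
    b * g (suc n) + ((λ _ → 0#) ⊛ g) n     ≈⟨ +-congˡ (zero-⊛ g n) ⟩
    b * g (suc n) + 0#                     ≈⟨ +-identityʳ _ ⟩
    b * g (suc n)                          ∎

  -- Formulated for any series without constant term, so that it and `shift-⊛-suc` apply to `t` and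
  -- to `t ⊛ f` alike; the left-nested `t ⊛ f ⊛ g` is then handled without associativity of `⊛`.
  shift-⊛-0 : ∀ f g → f 0 ≈ 0# → (f ⊛ g) 0 ≈ 0#
  shift-⊛-0 f g f0 = trans (⊛-0 f g) (trans (*-congʳ f0) (zeroˡ _))

  shift-⊛-suc : ∀ f g n → f 0 ≈ 0# → (f ⊛ g) (suc n) ≈ ((f ∘ suc) ⊛ g) n
  shift-⊛-suc f g n f0 = begin
    (f ⊛ g) (suc n)                        ≈⟨ ⊛-suc f g n ⟩
    f 0 * g (suc n) + ((f ∘ suc) ⊛ g) n    ≈⟨ +-congʳ (trans (*-congʳ f0) (zeroˡ _)) ⟩
    0# + ((f ∘ suc) ⊛ g) n                 ≈⟨ +-identityˡ _ ⟩
    ((f ∘ suc) ⊛ g) n                      ∎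

  t-⊛-0 : ∀ g → (t ⊛ g) 0 ≈ 0#
  t-⊛-0 g = shift-⊛-0 t g refl

  t-⊛-suc : ∀ g n → (t ⊛ g) (suc n) ≈ g n
  t-⊛-suc g n = begin
    (t ⊛ g) (suc n)        ≈⟨ shift-⊛-suc t g n refl ⟩
    ((t ∘ suc) ⊛ g) n      ≈⟨ ⊛-congʳ g (λ { zero → refl ; (suc _) → refl }) n ⟩
    (const 1# ⊛ g) n       ≈⟨ const-⊛ 1# g n ⟩
    1# * g n               ≈⟨ *-identityˡ _ ⟩
    g n                    ∎

  t⊛f⊛g-0 : ∀ f g → (t ⊛ f ⊛ g) 0 ≈ 0#
  t⊛f⊛g-0 f g = shift-⊛-0 (t ⊛ f) g (t-⊛-0 f)

  t⊛f⊛g-suc : ∀ f g n → (t ⊛ f ⊛ g) (suc n) ≈ (f ⊛ g) n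
  t⊛f⊛g-suc f g n = trans (shift-⊛-suc (t ⊛ f) g n (t-⊛-0 f)) (⊛-congʳ g (t-⊛-suc f) n)

  -- Weighted lattice paths and their first visit to height 0.

  -- Total weight of the lattice paths with a up-steps left that go from height
  -- h (in afterUp: from height h + 1, just after an up-step) down to 0, where a
  -- peak at height i + 1 weighs w i.
  mutual
    paths : (ℕ → Carrier) → ℕ → ℕ → Carrier
    paths w zero    zero    = 1#
    paths w zero    (suc h) = paths w zero h
    paths w (suc a) zero    = afterUp w a zero
    paths w (suc a) (suc h) = paths w (suc a) h + afterUp w a (suc h)

    afterUp : (ℕ → Carrier) → ℕ → ℕ → Carrier
    afterUp w zero    h = w h * paths w zero h
    afterUp w (suc a) h = w h * paths w (suc a) h + afterUp w a (suc h)

  mutual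
    paths-cong : ∀ {w w′} → (∀ i → w i ≈ w′ i) → ∀ a h → paths w a h ≈ paths w′ a h
    paths-cong e zero zero = refl
    paths-cong e zero (suc h) = paths-cong e zero h
    paths-cong e (suc a) zero = afterUp-cong e a zero
    paths-cong e (suc a) (suc h) = +-cong (paths-cong e (suc a) h) (afterUp-cong e a (suc h))

    afterUp-cong : ∀ {w w′} → (∀ i → w i ≈ w′ i) → ∀ a h → afterUp w a h ≈ afterUp w′ a h
    afterUp-cong e zero h = *-cong (e h) (paths-cong e zero h)
    afterUp-cong e (suc a) h = +-cong (*-cong (e h) (paths-cong e (suc a) h)) (afterUp-cong e a (suc h))

  module _ (w : ℕ → Carrier) where

    dyck : Series
    dyck n = paths w n 0

    -- Cut the path at its first visit to height 0.
    mutual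
      paths-first-visit : ∀ a h → paths w a (suc h) ≈ ((λ i → paths (w ∘ suc) i h) ⊛ dyck) a
      paths-first-visit zero zero = sym (trans (⊛-0 (λ i → paths (w ∘ suc) i 0) dyck) (*-identityˡ 1#))
      paths-first-visit zero (suc h) = paths-first-visit zero h
      paths-first-visit (suc a) zero = begin
        dyck (suc a) + afterUp w a 1
          -- An immediate down-step reaches 0 with no up-step used: this is the term of index 0,
          -- whose first factor is `1#`.
          ≈⟨ +-cong (sym (*-identityˡ _)) (afterUp-first-visit a 0) ⟩
        1# * dyck (suc a) + ((λ i → afterUp (w ∘ suc) i 0) ⊛ dyck) a
          ≈⟨ ⊛-suc (λ i → paths (w ∘ suc) i 0) dyck a ⟨
        ((λ i → paths (w ∘ suc) i 0) ⊛ dyck) (suc a) ∎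
      paths-first-visit (suc a) (suc h) = begin
        paths w (suc a) (suc h) + afterUp w a (suc (suc h))
          ≈⟨ +-cong (paths-first-visit (suc a) h) (afterUp-first-visit a (suc h)) ⟩
        (f ⊛ dyck) (suc a) + (g ⊛ dyck) a
          -- From height `suc h` the first part weighs `f 0` without up-steps and `f (suc i) + g i`
          -- with `suc i` of them, so index 0 is split off before the two convolutions are merged.
          ≈⟨ +-congʳ (⊛-suc f dyck a) ⟩
        f 0 * dyck (suc a) + ((f ∘ suc) ⊛ dyck) a + (g ⊛ dyck) a
          ≈⟨ +-assoc _ _ _ ⟩
        f 0 * dyck (suc a) + (((f ∘ suc) ⊛ dyck) a + (g ⊛ dyck) a)
          ≈⟨ +-congˡ (⊛-distribʳ (f ∘ suc) g dyck a) ⟨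
        f 0 * dyck (suc a) + ((f ∘ suc ⊕ g) ⊛ dyck) a
          ≈⟨ ⊛-suc (λ i → paths (w ∘ suc) i (suc h)) dyck a ⟨
        ((λ i → paths (w ∘ suc) i (suc h)) ⊛ dyck) (suc a) ∎
        where
        f g : Series
        f i = paths (w ∘ suc) i h
        g i = afterUp (w ∘ suc) i (suc h)

      afterUp-first-visit : ∀ a h → afterUp w a (suc h) ≈ ((λ i → afterUp (w ∘ suc) i h) ⊛ dyck) a
      afterUp-first-visit zero h = begin
        w (suc h) * paths w 0 (suc h)         ≈⟨ *-congˡ (paths-first-visit 0 h) ⟩
        w (suc h) * (f ⊛ dyck) 0              ≈⟨ *-congˡ (⊛-0 f dyck) ⟩
        w (suc h) * (f 0 * dyck 0)            ≈⟨ *-assoc _ _ _ ⟨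
        w (suc h) * f 0 * dyck 0              ≈⟨ ⊛-0 (λ i → afterUp (w ∘ suc) i h) dyck ⟨
        ((λ i → afterUp (w ∘ suc) i h) ⊛ dyck) 0 ∎
        where
        f : Series
        f i = paths (w ∘ suc) i h
      afterUp-first-visit (suc a) h = begin
        w (suc h) * paths w (suc a) (suc h) + afterUp w a (suc (suc h))
          ≈⟨ +-cong (*-congˡ (paths-first-visit (suc a) h)) (afterUp-first-visit a (suc h)) ⟩
        w (suc h) * (f ⊛ dyck) (suc a) + (g ⊛ dyck) a
          ≈⟨ +-congʳ (trans (*-congˡ (⊛-suc f dyck a)) (distribˡ _ _ _)) ⟩
        w (suc h) * (f 0 * dyck (suc a)) + w (suc h) * ((f ∘ suc) ⊛ dyck) a + (g ⊛ dyck) a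
          ≈⟨ +-congʳ (+-cong (*-assoc _ _ _) (⊛-scale (w (suc h)) (f ∘ suc) dyck a)) ⟨
        w (suc h) * f 0 * dyck (suc a) + (wf ⊛ dyck) a + (g ⊛ dyck) a
          ≈⟨ +-assoc _ _ _ ⟩
        w (suc h) * f 0 * dyck (suc a) + ((wf ⊛ dyck) a + (g ⊛ dyck) a)
          ≈⟨ +-congˡ (⊛-distribʳ wf g dyck a) ⟨
        w (suc h) * f 0 * dyck (suc a) + ((wf ⊕ g) ⊛ dyck) a
          ≈⟨ ⊛-suc (λ i → afterUp (w ∘ suc) i h) dyck a ⟨
        ((λ i → afterUp (w ∘ suc) i h) ⊛ dyck) (suc a) ∎
        where
        f g wf : Series
        f i = paths (w ∘ suc) i h
        g i = afterUp (w ∘ suc) i (suc h)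
        wf i = w (suc h) * f (suc i)

  -- Up to its first return the path is an up-step, a Dyck path raised by one, and a down-step. If
  -- the raised part is empty, this is a peak at height 1, of weight `w 0`; otherwise the raised
  -- part has `k ∸ 1` up-steps.
  dyck-suc : ∀ w n → dyck w (suc n) ≈ w 0 * dyck w n
    + sum (range 2 (suc n)) (λ k → dyck (w ∘ suc) (k ∸ 1) * dyck w (suc n ∸ k))
  dyck-suc w zero = sym (+-identityʳ _)
  -- Here `afterUp (w ∘ suc) i 0` is `dyck (w ∘ suc) (suc i)`, whence `k = i + 2`.
  dyck-suc w (suc n) = +-congˡ (trans (afterUp-first-visit w n 0)
    (sum-applyUpTo-cong id (λ i → suc (suc i)) (suc n) λ _ → refl))

  -- Peak weights under the change of arguments.

  -- The variables in the vector are x_(k+1), x_(k+2), ….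
  peakX : ∀ {p} → ℕ → ℕ → Vec Carrier p → Carrier
  peakX k c []       = 1#
  peakX k c (x ∷ xs) = x ^ (c C k) * peakX (suc k) c xs

  peak : ∀ {p} → Carrier → Vec Carrier p → ℕ → Carrier
  peak s x c = s * peakX 1 c x

  peakX-0 : ∀ {p} k (xs : Vec Carrier p) → peakX (suc k) 0 xs ≈ 1#
  peakX-0 k [] = refl
  peakX-0 k (x ∷ xs) = trans
    (*-cong (^-congʳ x (k>n⇒nCk≡0 {0} {suc k} (s≤s z≤n))) (peakX-0 (suc k) xs)) (*-identityˡ 1#)

  pascal : ∀ k c x → x ^ (suc c C suc k) ≈ x ^ (c C k) * x ^ (c C suc k)
  pascal k c x = trans (^-congʳ x (≡.sym (nCk+nC[k+1]≡[n+1]C[k+1] c k))) (^-homo-* x (c C k) (c C suc k))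

  -- Pascal's rule splits the power of each variable in two. The part with exponent `c C suc k`
  -- joins the equal power split off from the next variable `y`, giving a power of `x * y`; the part
  -- `x ^ (c C k)` of the first variable is left over.
  peakX-suc : ∀ {p} k c x (xs : Vec Carrier p) →
              peakX (suc k) (suc c) (x ∷ xs) ≈ x ^ (c C k) * peakX (suc k) c (x̂ (x ∷ xs))
  peakX-suc k c x [] = trans (*-congʳ (pascal k c x)) (*-assoc _ _ _)
  peakX-suc k c x (y ∷ ys) = begin
    x ^ (suc c C suc k) * peakX (suc (suc k)) (suc c) (y ∷ ys)
      ≈⟨ *-cong (pascal k c x) (peakX-suc (suc k) c y ys) ⟩
    x ^ (c C k) * x ^ b * (y ^ b * Y)    ≈⟨ *-assoc _ _ _ ⟩
    x ^ (c C k) * (x ^ b * (y ^ b * Y))  ≈⟨ *-congˡ (*-assoc _ _ _) ⟨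
    x ^ (c C k) * (x ^ b * y ^ b * Y)    ≈⟨ *-congˡ (*-congʳ (^-distrib-* x y b)) ⟨
    x ^ (c C k) * ((x * y) ^ b * Y)      ∎
    where
    b = c C suc k
    Y = peakX (suc (suc k)) c (x̂ (y ∷ ys))

  peak-suc : ∀ {p} s (x : Vec Carrier p) c → peak s x (suc c) ≈ peak (ŝ s x) (x̂ x) c
  peak-suc s [] c = refl
  peak-suc s (x ∷ xs) c = begin
    s * peakX 1 (suc c) (x ∷ xs)                  ≈⟨ *-congˡ (peakX-suc 0 c x xs) ⟩
    -- The leftover factor `x ^ (c C 0)` is `x * 1#`; it is absorbed into the new first argument
    -- `s * x`.
    s * (x * 1# * peakX 1 c (x̂ (x ∷ xs)))         ≈⟨ *-assoc _ _ _ ⟨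
    s * (x * 1#) * peakX 1 c (x̂ (x ∷ xs))         ≈⟨ *-congʳ (*-congˡ (*-identityʳ x)) ⟩
    s * x * peakX 1 c (x̂ (x ∷ xs))                ∎

  -- From permutations to weighted Dyck paths.

  xWeight-∷ : ∀ {p} k (xs : Vec Carrier p) y w → Desc (above y w) →
    xWeight (suc k) xs (y ∷ w) ≈ peakX k (length (above y w)) xs * xWeight (suc k) xs w
  xWeight-∷ k [] y w d = sym (*-identityˡ 1#)
  xWeight-∷ k (x ∷ xs) y w d = trans
    (*-cong (trans (^-congʳ x (occr-pattern1↓-∷ k y w d)) (^-homo-* x (length (above y w) C k) _))
            (xWeight-∷ (suc k) xs y w d))
    (*-interchange _ _ _ _)

  module _ {p} (s : Carrier) (x : Vec Carrier p) where

    -- The share of a suffix `w` in the weight of a permutation, where `m` bounds the minima as in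
    -- `LRminBelow` and each occurrence is attributed to its first entry.
    weight : ℕ → List ℕ → Carrier
    weight m w = s ^ LRminBelow m w * xWeight 2 x w

    weight-min : ∀ {m y} w {S} → y < m → Desc S → above y w ≡ S →
                 weight m (y ∷ w) ≈ peak s x (length S) * weight y w
    weight-min {m} {y} w y<m d ≡.refl = trans
      (*-cong (^-congʳ s (LRminBelow-min {m} {y} {w} y<m)) (xWeight-∷ 1 x y w d))
      (*-interchange _ _ _ _)

    -- With no larger entry after it, `y` starts no occurrence of any pattern.
    weight-nonMin : ∀ {m y} w → m ≤ y → above y w ≡ [] → weight m (y ∷ w) ≈ weight m w
    weight-nonMin {m} {y} w m≤y e = *-cong
      (^-congʳ s (LRminBelow-nonMin {m} {y} {w} m≤y))
      (begin
        xWeight 2 x (y ∷ w)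
          ≈⟨ xWeight-∷ 1 x y w (≡.subst Desc (≡.sym e) []) ⟩
        peakX 1 (length (above y w)) x * xWeight 2 x w
          ≈⟨ *-congʳ (reflexive (≡.cong (λ v → peakX 1 (length v) x) e)) ⟩
        peakX 1 0 x * xWeight 2 x w
          ≈⟨ *-congʳ (peakX-0 0 x) ⟩
        1# * xWeight 2 x w
          ≈⟨ *-identityˡ _ ⟩
        xWeight 2 x w ∎)

    private
      sum-nonMin : ∀ a {m r S} → a ≤ r → m ≤ r → All (r >_) S →
        sum (map (r ∷_) (completions a S)) (weight m) ≈ sum (completions a S) (weight m)
      sum-nonMin a {m} {r} {S} a≤r m≤r r> = trans (sum-map (r ∷_) (completions a S) _)
        (sum-cong (All.map
          (λ {w} e → weight-nonMin w m≤r (≡.trans e (List.filter-none (r <?_) (All.map (≤⇒≯ ∘ <⇒≤) r>))))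
          (completions-above a S a≤r)))

      sum-min : ∀ a {m S} → suc a < m → Desc S → All (suc a <_) S →
        sum (map (suc a ∷_) (completions a S)) (weight m)
          ≈ peak s x (length S) * sum (completions a S) (weight (suc a))
      sum-min a {m} {S} a<m d a<S = trans (sum-map (suc a ∷_) (completions a S) _)
        (trans
          (sum-cong (All.map
            (λ {w} e → weight-min w a<m d (≡.trans e (List.filter-all (suc a <?_) a<S)))
            (completions-above a S (<⇒≤ (n<1+n a)))))
          (sum-*ˡ (completions a S) _ _))

    mutual
      -- `completions` and `paths` obey the same recursion, with `length S` as the height:
      -- considering a value as the next minimum is an up-step, placing an entry is a down-step.
      -- Placing the value just considered makes a peak at height `length S + 1`.
      sum-completions : ∀ a {m S} → a < m → All (m ≤_) S → Desc S →
        sum (completions a S) (weight m) ≈ paths (peak s x) a (length S)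
      sum-completions zero _ [] [] = begin
        1# * xWeight 2 x [] + 0#  ≈⟨ +-identityʳ _ ⟩
        1# * xWeight 2 x []       ≈⟨ *-identityˡ _ ⟩
        xWeight 2 x []            ≈⟨ xWeight-[] 1 x ⟩
        1#                        ∎
        where
        xWeight-[] : ∀ {p} k (xs : Vec Carrier p) → xWeight (suc k) xs [] ≈ 1#
        xWeight-[] k [] = refl
        xWeight-[] k (x ∷ xs) = trans (*-identityˡ _) (xWeight-[] (suc k) xs)
      sum-completions zero a<m (m≤r ∷ m≤S) (r> ∷ d) =
        trans (sum-nonMin zero z≤n m≤r r>) (sum-completions zero a<m m≤S d)
      sum-completions (suc a) a<m [] [] = sum-minFirst a a<m [] []
      sum-completions (suc a) {m} {r ∷ S} a<m (m≤r ∷ m≤S) (r> ∷ d) = trans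
        (sum-++ (map (r ∷_) (completions (suc a) S)) _ _)
        (+-cong
          (trans (sum-nonMin (suc a) (<⇒≤ (<-≤-trans a<m m≤r)) m≤r r>) (sum-completions (suc a) a<m m≤S d))
          (sum-minFirst a a<m (All.map (<-≤-trans a<m) (m≤r ∷ m≤S)) (r> ∷ d)))

      sum-minFirst : ∀ a {m S} → suc a < m → All (suc a <_) S → Desc S →
        sum (minFirst a S) (weight m) ≈ afterUp (peak s x) a (length S)
      sum-minFirst zero a<m a<S d =
        trans (sum-min zero a<m d a<S) (*-congˡ (sum-completions zero (s≤s z≤n) (All.map <⇒≤ a<S) d))
      sum-minFirst (suc a) {m} {S} a<m a<S d = trans
        (sum-++ (map (suc (suc a) ∷_) (completions (suc a) S)) _ _)
        (+-cong
          (trans (sum-min (suc a) a<m d a<S)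
            (*-congˡ (sum-completions (suc a) (n<1+n _) (All.map <⇒≤ a<S) d)))
          (trans
            (sum-minFirst a (<⇒≤ a<m) (All.++⁺ (All.map <⇒≤ a<S) (n<1+n _ ∷ [])) (desc-∷ʳ d a<S))
            -- The value passed over makes `S` longer by one, that is, the path has climbed one
            -- step.
            (reflexive (≡.cong (afterUp (peak s x) a)
              (≡.sym (↭-length (∷↭∷ʳ (suc (suc a)) S)))))))

    Qₙ≈dyck : ∀ n → Qₙ n s x ≈ dyck (peak s x) n
    Qₙ≈dyck n = begin
      Qₙ n s x
        ≈⟨ sum-↭ _ (perms123↭completions n) ⟩
      sum (completions n []) (λ σ → s ^ LRmin σ * xWeight 2 x σ)
        ≈⟨ sum-cong (All.map
             -- The initial bound `suc n` exceeds all entries, so that every left-to-right minimum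
             -- counts.
             (λ {σ} p → *-congʳ (^-congʳ s (LRmin≡LRminBelow σ
               (All-resp-↭ (↭-sym p) (All.map s≤s (down-≤ n))))))
             (completions-↭ n [])) ⟩
      sum (completions n []) (weight (suc n))
        ≈⟨ sum-completions n (n<1+n n) [] [] ⟩
      dyck (peak s x) n ∎

  -- The recurrence and the functional equation.

  Qₙ̂≈dyck : ∀ {p} n s (x : Vec Carrier p) → Qₙ n (ŝ s x) (x̂ x) ≈ dyck (peak s x ∘ suc) n
  Qₙ̂≈dyck n s x = trans (Qₙ≈dyck (ŝ s x) (x̂ x) n) (paths-cong (λ c → sym (peak-suc s x c)) n 0)

  Qₙ-suc : ∀ {p} n s (x : Vec Carrier p) → Qₙ (suc n) s x ≈
    s * Qₙ n s x + sum (range 2 (suc n)) (λ k → Qₙ (k ∸ 1) (ŝ s x) (x̂ x) * Qₙ (suc n ∸ k) s x)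
  Qₙ-suc n s x = begin
    Qₙ (suc n) s x
      ≈⟨ Qₙ≈dyck s x (suc n) ⟩
    dyck w (suc n)
      ≈⟨ dyck-suc w n ⟩
    w 0 * dyck w n + sum (range 2 (suc n)) (λ k → dyck (w ∘ suc) (k ∸ 1) * dyck w (suc n ∸ k))
      ≈⟨ +-cong
           -- The lowest peak, with no larger entries to its right, has weight `w 0 ≈ s`.
           (*-cong (sym (trans (*-congˡ (peakX-0 0 x)) (*-identityʳ s))) (Qₙ≈dyck s x n))
           (sum-cong (All.universal
             (λ k → *-cong (Qₙ̂≈dyck (k ∸ 1) s x) (Qₙ≈dyck s x (suc n ∸ k))) (range 2 (suc n)))) ⟨
    s * Qₙ n s x + sum (range 2 (suc n)) (λ k → Qₙ (k ∸ 1) (ŝ s x) (x̂ x) * Qₙ (suc n ∸ k) s x) ∎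
    where w = peak s x

  -- The coefficients are compared. The full product of the two series also has the term for
  -- `k = 1`, with first factor `Q̂ 0 ≈ 1#`, which is absent from the recurrence; replacing `s` by
  -- `s - 1#` compensates for it.
  Q-equation : ∀ {p} s (x : Vec Carrier p) →
    Q s x ≈ₛ const 1# ⊕ t ⊛ const (s - 1#) ⊛ Q s x ⊕ t ⊛ Q (ŝ s x) (x̂ x) ⊛ Q s x
  Q-equation s x zero = begin
    Qₙ 0 s x      ≈⟨ Qₙ≈dyck s x 0 ⟩
    1#            ≈⟨ +-identityʳ 1# ⟨
    1# + 0#       ≈⟨ +-identityʳ _ ⟨
    1# + 0# + 0#  ≈⟨ +-cong (+-congˡ (t⊛f⊛g-0 (const (s - 1#)) (Q s x))) (t⊛f⊛g-0 (Q (ŝ s x) (x̂ x)) (Q s x)) ⟨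
    1# + (t ⊛ const (s - 1#) ⊛ Q s x) 0 + (t ⊛ Q (ŝ s x) (x̂ x) ⊛ Q s x) 0 ∎
  Q-equation s x (suc n) = begin
    Qₙ (suc n) s x
      ≈⟨ Qₙ-suc n s x ⟩
    s * q + r
      ≈⟨ +-congʳ (*-congʳ s≈) ⟩
    (s - 1# + 1#) * q + r
      ≈⟨ +-congʳ (distribʳ q (s - 1#) 1#) ⟩
    (s - 1#) * q + 1# * q + r
      ≈⟨ +-assoc _ _ _ ⟩
    (s - 1#) * q + (1# * q + r)
      ≈⟨ +-congˡ (+-congʳ (*-congʳ (Qₙ≈dyck (ŝ s x) (x̂ x) 0))) ⟨
    (s - 1#) * q + (Q̂ 0 * q + r)
      ≈⟨ +-cong (const-⊛ (s - 1#) (Q s x) n) (⊛-head Q̂ (Q s x) n) ⟨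
    (const (s - 1#) ⊛ Q s x) n + (Q̂ ⊛ Q s x) n
      ≈⟨ +-cong (t⊛f⊛g-suc (const (s - 1#)) (Q s x) n) (t⊛f⊛g-suc Q̂ (Q s x) n) ⟨
    (t ⊛ const (s - 1#) ⊛ Q s x) (suc n) + (t ⊛ Q̂ ⊛ Q s x) (suc n)
      ≈⟨ +-congʳ (+-identityˡ _) ⟨
    0# + (t ⊛ const (s - 1#) ⊛ Q s x) (suc n) + (t ⊛ Q̂ ⊛ Q s x) (suc n) ∎
    where
    q = Qₙ n s x
    Q̂ = Q (ŝ s x) (x̂ x)
    r = sum (range 2 (suc n)) (λ k → Q̂ (k ∸ 1) * Qₙ (suc n ∸ k) s x)
    s≈ : s ≈ s - 1# + 1#
    s≈ = begin
      s                ≈⟨ +-identityʳ s ⟨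
      s + 0#           ≈⟨ +-congˡ (-‿inverseˡ 1#) ⟨
      s + (- 1# + 1#)  ≈⟨ +-assoc _ _ _ ⟨
      s - 1# + 1#      ∎

theorem6 : ∀ {c ℓ} (R : CommutativeRing c ℓ) →
  let open CommutativeRing R
      open GeneratingFunctions R
  in
  (m : ℕ) → 2 ≤ m → (s : Carrier) (x : Vec Carrier (m ∸ 1)) →
    (∀ n → 1 ≤ n →
      Qₙ n s x ≈ s * Qₙ (n ∸ 1) s x
                 + sum (range 2 n) (λ k → Qₙ (k ∸ 1) (ŝ s x) (x̂ x) * Qₙ (n ∸ k) s x))
    × (Q s x ≈ₛ const 1# ⊕ t ⊛ const (s - 1#) ⊛ Q s x
                         ⊕ t ⊛ Q (ŝ s x) (x̂ x) ⊛ Q s x)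
theorem6 R m _ s x = (λ { (suc n) (s≤s _) → Qₙ-suc R n s x }) , Q-equation R s x
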